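{- The map $\Phi_x(u):=u+\frac{x}{1-u}$ is invertible on the set of formal power series in $x$ with zero constant term. Its inverse is $$\Psi_x(v):=\frac{1+v-\sqrt{(1-v)^2+4x}}{2},$$ where the square root is the one with constant term $1$; it is characterised by $\Phi_x(\Psi_x(v))=v$ together with $\Psi_x(v)$ having zero constant term. Consequently $$T(x)=\Psi_x^{\,3}\bigl(G(x)\bigr),\qquad G(x)=\frac{1-\sqrt{1-16x}}{2},$$ where $\Psi_x^{\,3}$ denotes the threefold iterate of $\Psi_x$.
   Context: Let $V_4=\{0<a<b<1\}$ be a four-element chain with Gödel implication $x\Rightarrow_G y=1$ if $x\le y$ and $x\Rightarrow_G y=y$ if $x>y$. For $n\ge1$, consider the $C_{n-1}$ full bracketings of $p_1\Rightarrow_G p_2\Rightarrow_G\cdots\Rightarrow_G p_n$ in $n$ distinct variables (equivalently, full binary trees with $n$ ordered leaves $p_1,\dots,p_n$), where $C_k$ is the $k$-th Catalan number. Let $t_n$ be the number of pairs (bracketing, valuation $\{p_1,\dots,p_n\}\to V_4$) for which the bracketed formula evaluates to $1$, and let $g_n=4^nC_{n-1}$ be the total number of such pairs. Put $T(x)=\sum_{n\ge1}t_nx^n$ and $G(x)=\sum_{n\ge1}g_nx^n$ (formal power series). -}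

module Defs where

open import Algebra.Properties.CommutativeMonoid.Sum using (sum)
open import Data.Bool using (if_then_else_)
open import Data.Fin using (Fin; suc; toℕ; opposite; _≤?_)
open import Data.Fin.Patterns using (3F)
open import Data.Integer using (+_)
open import Data.Nat using (ℕ; zero; suc; _∸_)
import Data.Nat as ℕ
import Data.Nat.Properties as ℕ
open import Data.Product using (Σ-syntax; _×_; _,_; proj₁)
open import Data.Rational using (ℚ; 0ℚ; 1ℚ; ½; _/_)
import Data.Rational as ℚ
import Data.Rational.Properties as ℚ
open import Data.Vec using (Vec; []; _∷_; take; drop)
open import Data.Vec.Functional using (Vector; init)
import Data.Vec.Functional as Vector
open import Relation.Binary.PropositionalEquality using (_≡_; refl; cong)
open import Relation.Nullary using (does)

-- The sequence a with a (n) = step (a (n-1), …, a (0)).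
-- The history handed to step lists the most recent term first.

history : {A : Set} → (∀ n → Vector A n → A) → ∀ n → Vector A n
history step zero    = Vector.[]
history step (suc n) = step n (history step n) Vector.∷ history step n

recursive : {A : Set} → (∀ n → Vector A n → A) → ℕ → A
recursive step n = step n (history step n)

Series : Set
Series = ℕ → ℚ

infix  4 _≈_ _≈₀_
infixl 6 _+_ _-_
infixl 7 _*_ _·_

_≈_ : Series → Series → Set
f ≈ g = ∀ n → f n ≡ g n

_+_ _-_ _*_ : Series → Series → Series
(f + g) n = f n ℚ.+ g n
(f - g) n = f n ℚ.- g n
(f * g) n = sum ℚ.+-0-commutativeMonoid {suc n} λ i →
              f (toℕ i) ℚ.* g (n ∸ toℕ i)

_·_ : ℚ → Series → Series
(c · f) n = c ℚ.* f n

one : Series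
one zero    = 1ℚ
one (suc _) = 0ℚ

X : Series
X (suc zero) = 1ℚ
X _          = 0ℚ

-- The reciprocal of a series f with constant term 1 (otherwise a junk value):
-- b (0) = 1 and b (n+1) = - (f (1) b (n) + … + f (n+1) b (0)).

recipStep : Series → ∀ n → Vector ℚ n → ℚ
recipStep f zero    _ = 1ℚ
recipStep f (suc n) b = ℚ.- sum ℚ.+-0-commutativeMonoid λ i →
                          f (suc (toℕ i)) ℚ.* b i

recip : Series → Series
recip f = recursive (recipStep f)

-- The square root with constant term 1 of a series f with constant term 1
-- (otherwise a junk value): s (0) = 1 and
-- s (n+1) = (f (n+1) - (s (n) s (1) + … + s (1) s (n))) / 2.

√Step : Series → ∀ n → Vector ℚ n → ℚ
√Step f zero    _ = 1ℚ
√Step f (suc n) s = ½ ℚ.* (f (suc n) ℚ.- sum ℚ.+-0-commutativeMonoid λ i →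
                      init s i ℚ.* init s (opposite i))

√ : Series → Series
√ f = recursive (√Step f)

IsUnitSqrt : Series → Series → Set
IsUnitSqrt s f = s 0 ≡ 1ℚ × s * s ≈ f

Series₀ : Set
Series₀ = Σ[ f ∈ Series ] f 0 ≡ 0ℚ

_≈₀_ : Series₀ → Series₀ → Set
f ≈₀ g = proj₁ f ≈ proj₁ g

Φ : Series₀ → Series₀
Φ (u , u₀≡0) = u + X * recip (one - u) , cong (ℚ._+ 0ℚ) u₀≡0

Ψ : Series₀ → Series₀
Ψ (v , v₀≡0) =
  ½ · (one + v - √ ((one - v) * (one - v) + (+ 4 / 1) · X)) ,
  cong (λ q → ½ ℚ.* ((1ℚ ℚ.+ q) ℚ.- 1ℚ)) v₀≡0

-- ∑_{n≥1} a (n) xⁿ; the value a (0) is ignored.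

genCoeff : (ℕ → ℕ) → Series
genCoeff a zero    = 0ℚ
genCoeff a (suc n) = + a (suc n) / 1

genFun : (ℕ → ℕ) → Series₀
genFun a = genCoeff a , refl

-- The chain 0 < a < b < 1 is Fin 4 with its usual order.

V₄ : Set
V₄ = Fin 4

𝟏 : V₄
𝟏 = 3F

infixr 5 _⇒ᴳ_ _⇒_

_⇒ᴳ_ : V₄ → V₄ → V₄
x ⇒ᴳ y = if does (x ≤? y) then 𝟏 else y

-- Full bracketings of p₁ ⇒ … ⇒ pₙ. The variables are determined by their
-- position, so leaves carry no label.

data Bracketing : ℕ → Set where
  var : Bracketing 1
  _⇒_ : ∀ {m n} → Bracketing m → Bracketing n → Bracketing (m ℕ.+ n)

Valuation : ℕ → Set
Valuation n = Vec V₄ n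

eval : ∀ {n} → Bracketing n → Valuation n → V₄
eval var             (x ∷ []) = x
eval (_⇒_ {m} φ ψ) ρ        = eval φ (take m ρ) ⇒ᴳ eval ψ (drop m ρ)

Pair : ℕ → Set
Pair n = Bracketing n × Valuation n

TruePair : ℕ → Set
TruePair n = Σ[ (φ , ρ) ∈ Pair n ] eval φ ρ ≡ 𝟏

-- C (0) = 1 and C (n+1) = C (n) C (0) + … + C (0) C (n).

catalanStep : ∀ n → Vector ℕ n → ℕ
catalanStep zero    _ = 1
catalanStep (suc n) c = sum ℕ.+-0-commutativeMonoid λ i →
                          c i ℕ.* c (opposite i)

catalan : ℕ → ℕ
catalan = recursive catalanStep

g : ℕ → ℕ
g n = 4 ℕ.^ n ℕ.* catalan (n ∸ 1)

G : Series₀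
G = genFun g

{-# OPTIONS --safe #-}

-- For v < 1 a bracketing takes the value v exactly when it is a single
-- variable of value v or an implication whose conclusion has value v and whose
-- premise exceeds v. Writing A≥, A> and A= for the generating functions of the
-- pairs with value ≥ v, > v and = v, this says A= = x + A> A=, that is
-- A= = x / (1 - A>), and so A≥ = A> + A= = Φ (A>). Starting from G, which
-- counts values ≥ 0, and removing the values 0, a and b in turn gives Φ³ (T) = G.
-- That Ψ inverts Φ is completing the square: both Φ (u) = v and u = Ψ (v) are
-- equivalent to (v - u)(1 - u) = x.
module Submission where

open import Defs
open import Algebra.Bundles using (CommutativeRing)
import Algebra.Construct.Pointwise as Pointwise
import Algebra.Properties.Group as GroupProperties
import Algebra.Properties.Semiring.Sum as SemiringSum
import Algebra.Solver.Ring as RingSolver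
open import Algebra.Solver.Ring.AlmostCommutativeRing
  using (fromCommutativeRing; _-Raw-AlmostCommutative⟶_; Induced-equivalence)
open import Data.Bool using (if_then_else_)
open import Data.Empty using (⊥-elim)
open import Data.Fin using (Fin; toℕ; opposite; inject₁; _≤?_; _<?_)
import Data.Fin as Fin
open import Data.Fin.Patterns using (0F; 1F; 2F; 3F)
open import Data.Fin.Permutation using (↔⇒≡)
open import Data.Fin.Properties
  using (+↔⊎; *↔×; toℕ<n; toℕ≤pred[n]; toℕ-inject₁; opposite-prop; _≟_; ≤-reflexive; ≤∧≢⇒<)
open import Data.Integer using (+_)
import Data.Integer as ℤ
import Data.Integer.Properties as ℤ
import Data.Maybe as Maybe
open import Data.Nat using (ℕ; zero; suc; _∸_; _≤_; z≤n; s≤s)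
import Data.Nat as ℕ
import Data.Nat.Coprimality as Coprimality
open import Data.Nat.Induction using (<-rec)
import Data.Nat.Properties as ℕ
open import Data.Product using (Σ; Σ-syntax; ∃; ∃-syntax; _×_; _,_; proj₁; proj₂; uncurry)
open import Data.Product.Algebra using (×-comm)
open import Data.Product.Function.Dependent.Propositional using (Σ-↔)
open import Data.Product.Function.NonDependent.Propositional using (_×-↔_)
open import Data.Rational using (ℚ; mkℚ; 0ℚ; 1ℚ; ½; _/_)
import Data.Rational as ℚ
import Data.Rational.Properties as ℚ
open import Data.Rational.Solver using (module +-*-Solver)
open import Data.Sum using (_⊎_; inj₁; inj₂; [_,_]′)
open import Data.Sum.Function.Propositional using (_⊎-↔_)
open import Data.Vec using (Vec; []; _∷_; _++_; take; drop)
open import Data.Vec.Functional using (Vector; init)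
open import Data.Vec.Properties using (take++drop≡id; ++-injective)
open import Function using (_∘_; _⇔_; mk⇔; Equivalence; Inverse; mk↔ₛ′)
open import Function.Bundles using (_↔_)
open import Function.Construct.Identity using (↔-id)
open import Function.Properties.Inverse using (↔-sym; ↔-trans)
open import Function.Structures _≈₀_ _≈₀_ using (IsInverse)
open import Level using (0ℓ)
open import Relation.Binary using (IsEquivalence; WeaklyDecidable)
open import Relation.Binary.PropositionalEquality
  using (_≡_; _≢_; refl; sym; trans; cong; cong₂; subst; module ≡-Reasoning)
import Relation.Binary.Reasoning.Setoid as SetoidReasoning
open import Relation.Nullary using (¬_; Dec; yes; no; does; contradiction; Irrelevant)
open import Relation.Nullary.Decidable using (dec⇒maybe)
open import Relation.Unary using (Decidable)
import Relation.Unary as Unary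

open SemiringSum (CommutativeRing.semiring ℚ.+-*-commutativeRing)
  using (sum; sum-cong-≗; sum-replicate-zero; ∑-distrib-+; *-distribˡ-sum)
open SemiringSum ℕ.+-*-semiring using ()
  renaming (sum to sumℕ; sum-cong-≗ to sumℕ-cong-≗; *-distribˡ-sum to *-distribˡ-sumℕ)

-- The ring of formal power series

zeros : Series
zeros _ = 0ℚ

-_ : Series → Series
(- f) n = ℚ.- f n

≈-refl : ∀ {f} → f ≈ f
≈-refl _ = refl

≈-sym : ∀ {f g} → f ≈ g → g ≈ f
≈-sym f≈g n = sym (f≈g n)

≈-trans : ∀ {f g h} → f ≈ g → g ≈ h → f ≈ h
≈-trans f≈g g≈h n = trans (f≈g n) (g≈h n)

*-cong : ∀ {f f′ g g′} → f ≈ f′ → g ≈ g′ → f * g ≈ f′ * g′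
*-cong f≈f′ g≈g′ n = sum-cong-≗ {suc n} λ i → cong₂ ℚ._*_ (f≈f′ (toℕ i)) (g≈g′ (n ∸ toℕ i))

*-distribʳ-+ : ∀ h f g → (f + g) * h ≈ f * h + g * h
*-distribʳ-+ h f g n = trans
  (sum-cong-≗ {suc n} λ i → ℚ.*-distribʳ-+ (h (n ∸ toℕ i)) (f (toℕ i)) (g (toℕ i)))
  (∑-distrib-+ {suc n} (λ i → f (toℕ i) ℚ.* h (n ∸ toℕ i)) (λ i → g (toℕ i) ℚ.* h (n ∸ toℕ i)))

·-*-assoc : ∀ c f g → (c · f) * g ≈ c · (f * g)
·-*-assoc c f g n = trans
  (sum-cong-≗ {suc n} λ i → ℚ.*-assoc c (f (toℕ i)) (g (n ∸ toℕ i)))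
  (sym (*-distribˡ-sum {suc n} c λ i → f (toℕ i) ℚ.* g (n ∸ toℕ i)))

*-zeroˡ : ∀ f → zeros * f ≈ zeros
*-zeroˡ f n = trans
  (sum-cong-≗ {suc n} λ i → ℚ.*-zeroˡ (f (n ∸ toℕ i))) (sum-replicate-zero (suc n))

*-identityˡ : ∀ f → one * f ≈ f
*-identityˡ f zero    = trans (ℚ.+-identityʳ _) (ℚ.*-identityˡ (f 0))
*-identityˡ f (suc n) = trans
  (cong₂ ℚ._+_ (ℚ.*-identityˡ (f (suc n))) (*-zeroˡ f n)) (ℚ.+-identityʳ _)

-- The sum in `_*_` unfolds by itself at the end containing `f 0`. This peels off the opposite end,
-- which contains `g 0`, and comparing the two expansions gives commutativity.
*-sucʳ : ∀ f g n → (f * g) (suc n) ≡ f (suc n) ℚ.* g 0 ℚ.+ (f * (g ∘ suc)) n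
*-sucʳ f g zero    =
  solve 4 (λ f₀ f₁ g₀ g₁ → f₀ :* g₁ :+ (f₁ :* g₀ :+ con 0ℚ)
                         := f₁ :* g₀ :+ (f₀ :* g₁ :+ con 0ℚ))
    refl (f 0) (f 1) (g 0) (g 1)
  where open +-*-Solver
*-sucʳ f g (suc n) = trans
  (cong (f 0 ℚ.* g (suc (suc n)) ℚ.+_) (*-sucʳ (f ∘ suc) g n))
  (solve 3 (λ a b c → a :+ (b :+ c) := b :+ (a :+ c)) refl
    (f 0 ℚ.* g (suc (suc n))) (f (suc (suc n)) ℚ.* g 0) (((f ∘ suc) * (g ∘ suc)) n))
  where open +-*-Solver

*-comm : ∀ f g → f * g ≈ g * f
*-comm f g zero    = cong (ℚ._+ 0ℚ) (ℚ.*-comm (f 0) (g 0))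
*-comm f g (suc n) = trans
  (cong₂ ℚ._+_ (ℚ.*-comm (f 0) (g (suc n))) (*-comm (f ∘ suc) g n))
  (sym (*-sucʳ g f n))

-- Induction on the coefficient, for all series at once: by definition, shifting `f * g` by `suc`
-- gives `f 0 · (g ∘ suc) + (f ∘ suc) * g`, and the induction hypothesis applies to `f ∘ suc`.
*-assoc : ∀ f g h → (f * g) * h ≈ f * (g * h)
*-assoc f g h zero    =
  solve 3 (λ a b c → (a :* b :+ con 0ℚ) :* c :+ con 0ℚ := a :* (b :* c :+ con 0ℚ) :+ con 0ℚ)
    refl (f 0) (g 0) (h 0)
  where open +-*-Solver
*-assoc f g h (suc n) = begin
  (f 0 ℚ.* g 0 ℚ.+ 0ℚ) ℚ.* h (suc n) ℚ.+ ((f 0 · (g ∘ suc) + (f ∘ suc) * g) * h) n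
    ≡⟨ cong ((f 0 ℚ.* g 0 ℚ.+ 0ℚ) ℚ.* h (suc n) ℚ.+_)
         (trans (*-distribʳ-+ h (f 0 · (g ∘ suc)) ((f ∘ suc) * g) n)
           (cong₂ ℚ._+_ (·-*-assoc (f 0) (g ∘ suc) h n) (*-assoc (f ∘ suc) g h n))) ⟩
  (f 0 ℚ.* g 0 ℚ.+ 0ℚ) ℚ.* h (suc n) ℚ.+
    (f 0 ℚ.* ((g ∘ suc) * h) n ℚ.+ ((f ∘ suc) * (g * h)) n)
    ≡⟨ solve 5 (λ a b c d e → (a :* b :+ con 0ℚ) :* c :+ (a :* d :+ e)
                            := a :* (b :* c :+ d) :+ e)
         refl (f 0) (g 0) (h (suc n)) (((g ∘ suc) * h) n) (((f ∘ suc) * (g * h)) n) ⟩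
  f 0 ℚ.* (g 0 ℚ.* h (suc n) ℚ.+ ((g ∘ suc) * h) n) ℚ.+ ((f ∘ suc) * (g * h)) n ∎
  where
  open ≡-Reasoning
  open +-*-Solver

commutativeRing : CommutativeRing 0ℓ 0ℓ
commutativeRing = record
  { _≈_ = _≈_ ; _+_ = _+_ ; _*_ = _*_ ; -_ = -_ ; 0# = zeros ; 1# = one
  ; isCommutativeRing = record
    { isRing = record
      { +-isAbelianGroup = Pointwise.isAbelianGroup ℕ ℚ.+-0-isAbelianGroup
      ; *-cong           = *-cong
      ; *-assoc          = *-assoc
      ; *-identity       = *-identityˡ , λ f → ≈-trans (*-comm f one) (*-identityˡ f)
      ; distrib          = (λ h f g → ≈-trans (*-comm h (f + g)) (≈-trans (*-distribʳ-+ h f g)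
                             λ n → cong₂ ℚ._+_ (*-comm f h n) (*-comm g h n)))
                           , *-distribʳ-+
      }
    ; *-comm = *-comm
    }
  }

open CommutativeRing commutativeRing
  using (setoid; +-group; +-cong; +-congˡ; +-congʳ; -‿cong; *-congˡ; *-congʳ; *-identityʳ)
open GroupProperties +-group using (x∙y⁻¹≈ε⇒x≈y)

const : ℚ → Series
const c = c · one

-- Scalar multiples become ring products here, a form that the ring solver can handle.
·≈const* : ∀ c f → c · f ≈ const c * f
·≈const* c f = ≈-sym (≈-trans (·-*-assoc c one f) λ n → cong (c ℚ.*_) (*-identityˡ f n))

-- Rational numbers act as solver coefficients through constant series, so that completing the
-- square may use halves and quarters.
const-morphism : ℚ.+-*-rawRing -Raw-AlmostCommutative⟶ fromCommutativeRing commutativeRing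
const-morphism = record
  { ⟦_⟧    = const
  ; +-homo = λ a b n → ℚ.*-distribʳ-+ (one n) a b
  ; *-homo = λ a b → ≈-trans (λ n → ℚ.*-assoc a b (one n)) (·≈const* a (const b))
  ; -‿homo = λ a n → sym (ℚ.neg-distribˡ-* a (one n))
  ; 0-homo = λ n → ℚ.*-zeroˡ (one n)
  ; 1-homo = λ n → ℚ.*-identityˡ (one n)
  }

const-≟ : WeaklyDecidable (Induced-equivalence const-morphism)
const-≟ a b = Maybe.map (λ a≡b n → cong (ℚ._* one n) a≡b) (dec⇒maybe (a ℚ.≟ b))

-- const 1ℚ is not definitionally one, so the calls below pass one as a variable i
-- and the identities are arranged to be homogeneous.
module Solver =
  RingSolver ℚ.+-*-rawRing (fromCommutativeRing commutativeRing) const-morphism const-≟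

-- Reciprocals and square roots

-- Turns sums over a `history`, which runs backwards in time, into convolution sums.
history-lookup : ∀ {A : Set} (step : ∀ n → Vector A n → A) n i →
                 history step n i ≡ recursive step (n ∸ suc (toℕ i))
history-lookup step (suc n) Fin.zero    = refl
history-lookup step (suc n) (Fin.suc i) = history-lookup step n i

*-recip : ∀ f → f 0 ≡ 1ℚ → f * recip f ≈ one
*-recip f f₀≡1 zero    = cong (λ q → q ℚ.* 1ℚ ℚ.+ 0ℚ) f₀≡1
*-recip f f₀≡1 (suc n) = begin
  f 0 ℚ.* recip f (suc n) ℚ.+ ((f ∘ suc) * recip f) n
    ≡⟨ cong₂ (λ p q → p ℚ.* q ℚ.+ ((f ∘ suc) * recip f) n) f₀≡1 (cong ℚ.-_
         (sum-cong-≗ {suc n} λ i → cong (f (suc (toℕ i)) ℚ.*_)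
           (history-lookup (recipStep f) (suc n) i))) ⟩
  -- `recipStep` defines the new coefficient as the negative of exactly the rest of this
  -- convolution.
  1ℚ ℚ.* (ℚ.- ((f ∘ suc) * recip f) n) ℚ.+ ((f ∘ suc) * recip f) n
    ≡⟨ solve 1 (λ x → con 1ℚ :* (:- x) :+ x := con 0ℚ) refl (((f ∘ suc) * recip f) n) ⟩
  0ℚ ∎
  where
  open ≡-Reasoning
  open +-*-Solver

toQuotient : ∀ {f g h} → f 0 ≡ 1ℚ → h * f ≈ g → h ≈ g * recip f
toQuotient {f} {g} {h} f₀≡1 hf≈g = begin
  h                   ≈⟨ *-identityʳ h ⟨
  h * one             ≈⟨ *-congˡ {h} (*-recip f f₀≡1) ⟨
  h * (f * recip f)   ≈⟨ *-assoc h f (recip f) ⟨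
  h * f * recip f     ≈⟨ *-congʳ hf≈g ⟩
  g * recip f         ∎
  where open SetoidReasoning setoid

fromQuotient : ∀ {f g h} → f 0 ≡ 1ℚ → h ≈ g * recip f → h * f ≈ g
fromQuotient {f} {g} {h} f₀≡1 h≈g/f = begin
  h * f               ≈⟨ *-congʳ h≈g/f ⟩
  g * recip f * f     ≈⟨ *-assoc g (recip f) f ⟩
  g * (recip f * f)   ≈⟨ *-congˡ {g} (≈-trans (*-comm (recip f) f) (*-recip f f₀≡1)) ⟩
  g * one             ≈⟨ *-identityʳ g ⟩
  g                   ∎
  where open SetoidReasoning setoid

*-cancel-zero : ∀ {f h} → f 0 ≡ 1ℚ → h * f ≈ zeros → h ≈ zeros
*-cancel-zero {f} f₀≡1 hf≈0 = ≈-trans (toQuotient f₀≡1 hf≈0) (*-zeroˡ (recip f))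

-- The history is `√ f (suc n)`, ..., `√ f 0`, and `init` drops the final `√ f 0`. The remaining
-- products are the convolution of `√ f ∘ suc` with itself, with the two factors swapped because the
-- history runs backwards.
√-suc-suc : ∀ f n → √ f (suc (suc n)) ≡
            ½ ℚ.* (f (suc (suc n)) ℚ.- ((√ f ∘ suc) * (√ f ∘ suc)) n)
√-suc-suc f n = cong (λ q → ½ ℚ.* (f (suc (suc n)) ℚ.- q)) (sum-cong-≗ {suc n} λ i →
  trans (ℚ.*-comm (previous i) (previous (opposite i))) (cong₂ ℚ._*_
    (trans (previous-lookup (opposite i)) (cong (√ f) (suc-n∸opposite i)))
    (trans (previous-lookup i) (cong (√ f) (ℕ.+-∸-assoc 1 (toℕ≤pred[n] i))))))
  where
  previous : Vector ℚ (suc n)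
  previous = init (history (√Step f) (suc (suc n)))

  previous-lookup : ∀ i → previous i ≡ √ f (suc n ∸ toℕ i)
  previous-lookup i = trans (history-lookup (√Step f) (suc (suc n)) (inject₁ i))
    (cong (λ k → √ f (suc n ∸ k)) (toℕ-inject₁ i))

  suc-n∸opposite : ∀ i → suc n ∸ toℕ (opposite i) ≡ suc (toℕ i)
  suc-n∸opposite i = trans (cong (suc n ∸_) (opposite-prop i)) (ℕ.m∸[m∸n]≡n (toℕ<n i))

√-square : ∀ f → f 0 ≡ 1ℚ → √ f * √ f ≈ f
√-square f f₀≡1 zero          = sym f₀≡1
-- The sum of middle products is empty for this coefficient, hence the literal `0ℚ`.
√-square f f₀≡1 (suc zero)    =
  solve 1 (λ a → con 1ℚ :* (con ½ :* (a :- con 0ℚ)) :+ (con ½ :* (a :- con 0ℚ) :* con 1ℚ :+ con 0ℚ)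
               := a) refl (f 1)
  where open +-*-Solver
-- Since `√ f 0` is 1, both end terms equal `√ f (suc (suc n))`. What remains is the middle sum `m`,
-- which the recursion subtracts before halving.
√-square f f₀≡1 (suc (suc n)) = begin
  1ℚ ℚ.* √ f (suc (suc n)) ℚ.+ ((√ f ∘ suc) * √ f) (suc n)
    ≡⟨ cong (1ℚ ℚ.* √ f (suc (suc n)) ℚ.+_) (*-sucʳ (√ f ∘ suc) (√ f) n) ⟩
  1ℚ ℚ.* √ f (suc (suc n)) ℚ.+ (√ f (suc (suc n)) ℚ.* 1ℚ ℚ.+ m)
    ≡⟨ cong (λ q → 1ℚ ℚ.* q ℚ.+ (q ℚ.* 1ℚ ℚ.+ m)) (√-suc-suc f n) ⟩
  1ℚ ℚ.* (½ ℚ.* (f (suc (suc n)) ℚ.- m)) ℚ.+ (½ ℚ.* (f (suc (suc n)) ℚ.- m) ℚ.* 1ℚ ℚ.+ m)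
    ≡⟨ solve 2 (λ a m → con 1ℚ :* (con ½ :* (a :- m)) :+ (con ½ :* (a :- m) :* con 1ℚ :+ m) := a)
         refl (f (suc (suc n))) m ⟩
  f (suc (suc n)) ∎
  where
  open ≡-Reasoning
  open +-*-Solver
  m : ℚ
  m = ((√ f ∘ suc) * (√ f ∘ suc)) n

√-isUnitSqrt : ∀ f → f 0 ≡ 1ℚ → IsUnitSqrt (√ f) f
√-isUnitSqrt f f₀≡1 = refl , √-square f f₀≡1

-- (r - s)(r + s) = 0, and r + s cancels because its constant term is 2.
isUnitSqrt-unique : ∀ {f r s} → IsUnitSqrt r f → IsUnitSqrt s f → r ≈ s
isUnitSqrt-unique {f} {r} {s} (r₀≡1 , r²≈f) (s₀≡1 , s²≈f) = x∙y⁻¹≈ε⇒x≈y r s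
  (*-cancel-zero {const ½ * (r + s)} {r - s}
    (cong₂ (λ p q → ½ ℚ.* 1ℚ ℚ.* (p ℚ.+ q) ℚ.+ 0ℚ) r₀≡1 s₀≡1) (begin
    (r - s) * (const ½ * (r + s))  ≈⟨ solve 2 (λ r s → (r :- s) :* (con ½ :* (r :+ s))
                                               := con ½ :* (r :* r :- s :* s)) ≈-refl r s ⟩
    const ½ * (r * r - s * s)      ≈⟨ *-congˡ {const ½} (+-cong r²≈f (-‿cong s²≈f)) ⟩
    const ½ * (f - f)              ≈⟨ solve 1 (λ f → con ½ :* (f :- f) := con 0ℚ) ≈-refl f ⟩
    const 0ℚ                       ≈⟨ (λ n → ℚ.*-zeroˡ (one n)) ⟩
    zeros                          ∎))
  where
  open SetoidReasoning setoid
  open Solver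

-- The maps Φ and Ψ

-- The equation `Φ u = v` with its denominator cleared, a quadratic in u. When v has zero constant
-- term, every root has constant term 0 or 1, and `Ψ v` is the one with 0.
Root : Series → Series → Set
Root u v = (v - u) * (one - u) ≈ X

root-cong : ∀ {u u′ v v′} → u ≈ u′ → v ≈ v′ → Root u v → Root u′ v′
root-cong {u} {u′} {v} {v′} u≈u′ v≈v′ root = ≈-trans
  (*-cong {v′ - u′} {v - u} {one - u′} {one - u}
    (+-cong (≈-sym v≈v′) (-‿cong (≈-sym u≈u′)))
    (+-congˡ {one} (-‿cong (≈-sym u≈u′))))
  root

one-u₀≡1 : ∀ (u : Series₀) → (one - proj₁ u) 0 ≡ 1ℚ
one-u₀≡1 (u , u₀≡0) = cong (λ q → 1ℚ ℚ.- q) u₀≡0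

Φ⇒root : ∀ u v → Φ u ≈₀ v → Root (proj₁ u) (proj₁ v)
Φ⇒root u₀@(u , _) (v , _) Φu≈v = fromQuotient {one - u} {X} {v - u} (one-u₀≡1 u₀) (begin
  v - u                            ≈⟨ +-congʳ { - u} (≈-sym Φu≈v) ⟩
  u + X * recip (one - u) - u      ≈⟨ solve 2 (λ u q → u :+ q :- u := q) ≈-refl
                                        u (X * recip (one - u)) ⟩
  X * recip (one - u)              ∎)
  where
  open SetoidReasoning setoid
  open Solver

root⇒Φ : ∀ u v → Root (proj₁ u) (proj₁ v) → Φ u ≈₀ v
root⇒Φ u₀@(u , _) (v , _) root = begin
  u + X * recip (one - u)  ≈⟨ +-congˡ {u} (toQuotient {one - u} {X} {v - u} (one-u₀≡1 u₀) root) ⟨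
  u + (v - u)              ≈⟨ solve 2 (λ u v → u :+ (v :- u) := v) ≈-refl u v ⟩
  v                        ∎
  where
  open SetoidReasoning setoid
  open Solver

-- The discriminant of u² - (1 + v) u + (v - x), since (1 + v)² - 4 (v - x) = (1 - v)² + 4x.
discriminant : Series → Series
discriminant v = (one - v) * (one - v) + (+ 4 / 1) · X

discriminant₀≡1 : ∀ (v : Series₀) → discriminant (proj₁ v) 0 ≡ 1ℚ
discriminant₀≡1 (v , v₀≡0) =
  cong (λ q → (1ℚ ℚ.- q) ℚ.* (1ℚ ℚ.- q) ℚ.+ 0ℚ ℚ.+ (+ 4 / 1) ℚ.* 0ℚ) v₀≡0

½·≈const* : ∀ f → ½ · f ≈ const ½ * f
½·≈const* = ·≈const* ½

Ψ⇒root : ∀ u v → u ≈₀ Ψ v → Root (proj₁ u) (proj₁ v)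
Ψ⇒root (u , _) v₀@(v , _) u≈Ψv = root-cong {const ½ * (one + v - s)} {u} {v} {v}
  (≈-sym (≈-trans u≈Ψv (½·≈const* (one + v - s)))) ≈-refl (begin
  (v - const ½ * (one + v - s)) * (one - const ½ * (one + v - s))
    -- The factors are ½ (s - (1 - v)) and ½ (s + (1 - v)), so their product is a difference of
    -- squares.
    ≈⟨ solve 3 (λ i v s →
         (v :- con ½ :* (i :+ v :- s)) :* (i :- con ½ :* (i :+ v :- s))
         := con (+ 1 / 4) :* (s :* s :- (i :- v) :* (i :- v))) ≈-refl one v s ⟩
  const (+ 1 / 4) * (s * s - (one - v) * (one - v))
    ≈⟨ *-congˡ {const (+ 1 / 4)} (+-congʳ { - ((one - v) * (one - v))}
         (≈-trans (√-square (discriminant v) (discriminant₀≡1 v₀))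
           (+-congˡ {(one - v) * (one - v)} (·≈const* (+ 4 / 1) X)))) ⟩
  const (+ 1 / 4) * ((one - v) * (one - v) + const (+ 4 / 1) * X - (one - v) * (one - v))
    ≈⟨ solve 2 (λ q x → con (+ 1 / 4) :* (q :+ con (+ 4 / 1) :* x :- q) := x)
         ≈-refl ((one - v) * (one - v)) X ⟩
  X ∎)
  where
  open SetoidReasoning setoid
  open Solver
  s : Series
  s = √ (discriminant v)

root⇒Ψ : ∀ u v → Root (proj₁ u) (proj₁ v) → u ≈₀ Ψ v
root⇒Ψ (u , u₀≡0) v₀@(v , v₀≡0) root = begin
  u
    ≈⟨ solve 3 (λ i u v → u := con ½ :* (i :+ v :- (i :+ v :- con (+ 2 / 1) :* u))) ≈-refl one u v ⟩
  const ½ * (one + v - s)                   ≈⟨ *-congˡ {const ½} (+-congˡ {one + v} (-‿cong s≈√)) ⟩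
  const ½ * (one + v - √ (discriminant v))  ≈⟨ ½·≈const* (one + v - √ (discriminant v)) ⟨
  ½ · (one + v - √ (discriminant v))        ∎
  where
  open SetoidReasoning setoid
  open Solver
  s : Series
  -- Found by solving u = ½ (1 + v - s) for s. Its constant term is 1 because u and v have none,
  -- which singles out the branch `√`.
  s = one + v - const (+ 2 / 1) * u

  s²≈ : s * s ≈ discriminant v
  s²≈ = begin
    s * s
      ≈⟨ solve 3 (λ i u v →
           (i :+ v :- con (+ 2 / 1) :* u) :* (i :+ v :- con (+ 2 / 1) :* u)
           := (i :- v) :* (i :- v) :+ con (+ 4 / 1) :* ((v :- u) :* (i :- u))) ≈-refl one u v ⟩
    (one - v) * (one - v) + const (+ 4 / 1) * ((v - u) * (one - u))
      ≈⟨ +-congˡ {(one - v) * (one - v)} (*-congˡ {const (+ 4 / 1)} root) ⟩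
    (one - v) * (one - v) + const (+ 4 / 1) * X
      ≈⟨ +-congˡ {(one - v) * (one - v)} (·≈const* (+ 4 / 1) X) ⟨
    discriminant v ∎

  s≈√ : s ≈ √ (discriminant v)
  s≈√ = isUnitSqrt-unique {discriminant v} {s} {√ (discriminant v)}
    (cong₂ (λ p q → 1ℚ ℚ.+ p ℚ.- ((+ 2 / 1) ℚ.* 1ℚ ℚ.* q ℚ.+ 0ℚ)) v₀≡0 u₀≡0 , s²≈)
    (√-isUnitSqrt (discriminant v) (discriminant₀≡1 v₀))

Φ⇒Ψ : ∀ u v → Φ u ≈₀ v → u ≈₀ Ψ v
Φ⇒Ψ u v = root⇒Ψ u v ∘ Φ⇒root u v

Ψ⇒Φ : ∀ u v → u ≈₀ Ψ v → Φ u ≈₀ v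
Ψ⇒Φ u v = root⇒Φ u v ∘ Ψ⇒root u v

-- `Root` is built from ring operations only, so it visibly respects `_≈_`; passing through it
-- spares an argument about `recip` here and about `√` in `Ψ-cong`.
Φ-cong : ∀ {u u′} → u ≈₀ u′ → Φ u ≈₀ Φ u′
Φ-cong {u} {u′} u≈u′ = root⇒Φ u (Φ u′)
  (root-cong {proj₁ u′} {proj₁ u} {proj₁ (Φ u′)} {proj₁ (Φ u′)} (≈-sym u≈u′) ≈-refl
    (Φ⇒root u′ (Φ u′) ≈-refl))

Ψ-cong : ∀ {v v′} → v ≈₀ v′ → Ψ v ≈₀ Ψ v′
Ψ-cong {v} {v′} v≈v′ = root⇒Ψ (Ψ v) v′
  (root-cong {proj₁ (Ψ v)} {proj₁ (Ψ v)} {proj₁ v} {proj₁ v′} ≈-refl v≈v′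
    (Ψ⇒root (Ψ v) v ≈-refl))

≈₀-isEquivalence : IsEquivalence _≈₀_
≈₀-isEquivalence = record
  { refl = ≈-refl ; sym = λ f≈g → ≈-sym f≈g ; trans = λ f≈g g≈h → ≈-trans f≈g g≈h }

Φ-Ψ-isInverse : IsInverse Φ Ψ
Φ-Ψ-isInverse = record
  { isLeftInverse = record
    { isCongruent = record
      { cong = λ {u} {u′} → Φ-cong {u} {u′}
      ; isEquivalence₁ = ≈₀-isEquivalence
      ; isEquivalence₂ = ≈₀-isEquivalence
      }
    ; from-cong = λ {v} {v′} → Ψ-cong {v} {v′}
    ; inverseˡ = λ {v} {u} u≈Ψv → Ψ⇒Φ u v u≈Ψv
    }
  ; inverseʳ = λ {u} {v} v≈Φu → ≈-sym (Φ⇒Ψ u v (≈-sym v≈Φu))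
  }

-- Cardinalities of finite types

-- Numerical recurrences are obtained below by counting one type in two ways.
↔-card-unique : ∀ {A : Set} {m n} → A ↔ Fin m → A ↔ Fin n → m ≡ n
↔-card-unique A↔m A↔n = ↔⇒≡ (↔-trans (↔-sym A↔m) A↔n)

↔-card-resp : ∀ {A : Set} {m n} → m ≡ n → A ↔ Fin m → A ↔ Fin n
↔-card-resp refl A↔m = A↔m

⊎-card : ∀ {A B : Set} {m n} → A ↔ Fin m → B ↔ Fin n → (A ⊎ B) ↔ Fin (m ℕ.+ n)
⊎-card A↔m B↔n = ↔-trans (A↔m ⊎-↔ B↔n) (↔-sym +↔⊎)

×-card : ∀ {A B : Set} {m n} → A ↔ Fin m → B ↔ Fin n → (A × B) ↔ Fin (m ℕ.* n)
×-card A↔m B↔n = ↔-trans (A↔m ×-↔ B↔n) (↔-sym *↔×)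

Σ-Fin-card : ∀ n {P : Fin n → Set} (c : Vector ℕ n) → (∀ i → P i ↔ Fin (c i)) →
             Σ (Fin n) P ↔ Fin (sumℕ c)
Σ-Fin-card zero    c P↔c = mk↔ₛ′ (λ ()) (λ ()) (λ ()) (λ ())
Σ-Fin-card (suc n) c P↔c =
  ↔-trans split (⊎-card (P↔c Fin.zero) (Σ-Fin-card n (c ∘ Fin.suc) (P↔c ∘ Fin.suc)))
  where
  split = mk↔ₛ′
    (λ { (Fin.zero , p) → inj₁ p ; (Fin.suc i , p) → inj₂ (i , p) })
    [ Fin.zero ,_ , (λ (i , p) → Fin.suc i , p) ]′
    (λ { (inj₁ _) → refl ; (inj₂ _) → refl })
    (λ { (Fin.zero , _) → refl ; (Fin.suc _ , _) → refl })

singleton-card : ∀ {A : Set} (a : A) → (∀ b → a ≡ b) → A ↔ Fin 1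
singleton-card a a≡ = mk↔ₛ′ (λ _ → 0F) (λ _ → a) (λ { 0F → refl ; (Fin.suc ()) }) a≡

Dec-card : ∀ {P : Set} → Irrelevant P → (P? : Dec P) → P ↔ Fin (if does P? then 1 else 0)
Dec-card irr (yes p) = singleton-card p (irr p)
Dec-card irr (no ¬p) = mk↔ₛ′ (⊥-elim ∘ ¬p) (λ ()) (λ ()) (⊥-elim ∘ ¬p)

-- The cardinality is a sum of indicators over an enumeration of `A`; irrelevance makes each fibre
-- of size 0 or 1.
subset-finite : ∀ {A : Set} {P : A → Set} {n} → A ↔ Fin n → Unary.Irrelevant P → Decidable P →
                ∃[ m ] (Σ A P ↔ Fin m)
subset-finite {A} {P} A↔n irr P? = _ ,
  ↔-trans (↔-sym (Σ-↔ (↔-sym A↔n) (↔-id _)))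
    (Σ-Fin-card _ _ λ i → Dec-card irr (P? (Inverse.from A↔n i)))

-- The Cauchy product of graded families, the type-level counterpart of `conv`. Both sizes are
-- stored along with an equation, so that matching on `refl` lines up with the index `m ℕ.+ n` of
-- `_⇒_`.
Conv : (ℕ → Set) → (ℕ → Set) → ℕ → Set
Conv A B n = Σ[ m ∈ ℕ ] Σ[ k ∈ ℕ ] m ℕ.+ k ≡ n × A m × B k

conv : (ℕ → ℕ) → (ℕ → ℕ) → ℕ → ℕ
conv a b n = sumℕ {suc n} λ i → a (toℕ i) ℕ.* b (n ∸ toℕ i)

Conv-zero : ∀ {A B} → Conv A B 0 ↔ (A 0 × B 0)
Conv-zero = mk↔ₛ′ (λ { (zero , _ , refl , ab) → ab }) (λ ab → 0 , 0 , refl , ab)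
  (λ _ → refl) (λ { (zero , _ , refl , _) → refl })

Conv-suc : ∀ {A B n} → Conv A B (suc n) ↔ (A 0 × B (suc n) ⊎ Conv (A ∘ suc) B n)
Conv-suc = mk↔ₛ′
  (λ { (zero , _ , refl , ab) → inj₁ ab ; (suc m , k , refl , ab) → inj₂ (m , k , refl , ab) })
  (λ { (inj₁ ab) → 0 , _ , refl , ab ; (inj₂ (m , k , refl , ab)) → suc m , k , refl , ab })
  (λ { (inj₁ _) → refl ; (inj₂ (_ , _ , refl , _)) → refl })
  (λ { (zero , _ , refl , _) → refl ; (suc _ , _ , refl , _) → refl })

-- With nothing in size 0, both parts have size at least 1, hence at most n + 1. Removing one from
-- each size indexes them by 0 to n, which is what strong induction requires.
Conv-suc-suc : ∀ {A B n} → ¬ A 0 → ¬ B 0 → Conv A B (suc (suc n)) ↔ Conv (A ∘ suc) (B ∘ suc) n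
Conv-suc-suc {A} {B} {n} ¬A₀ ¬B₀ = mk↔ₛ′ to from
  (λ (m , k , _ , ab) → cong (λ eq → m , k , eq , ab) (ℕ.≡-irrelevant _ _))
  λ { (zero  , _     , _ , a , _) → contradiction a ¬A₀
    ; (suc _ , zero  , _ , _ , b) → contradiction b ¬B₀
    ; (suc m , suc k , _ , ab)    → cong (λ eq → suc m , suc k , eq , ab) (ℕ.≡-irrelevant _ _) }
  where
  to : Conv A B (suc (suc n)) → Conv (A ∘ suc) (B ∘ suc) n
  to (zero  , _     , _  , a , _) = contradiction a ¬A₀
  to (suc _ , zero  , _  , _ , b) = contradiction b ¬B₀
  to (suc m , suc k , eq , ab)    =
    m , k , ℕ.suc-injective (trans (sym (ℕ.+-suc m k)) (ℕ.suc-injective eq)) , ab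

  from : Conv (A ∘ suc) (B ∘ suc) n → Conv A B (suc (suc n))
  from (m , k , eq , ab) = suc m , suc k , cong suc (trans (ℕ.+-suc m k) (cong suc eq)) , ab

-- The hypotheses are confined to sizes up to n so that a strong induction hypothesis can be passed
-- in.
Conv-card : ∀ {A B a b} n → (∀ {m} → m ≤ n → A m ↔ Fin (a m)) →
            (∀ {m} → m ≤ n → B m ↔ Fin (b m)) → Conv A B n ↔ Fin (conv a b n)
Conv-card zero    A↔a B↔b =
  ↔-trans Conv-zero (↔-card-resp (sym (ℕ.+-identityʳ _)) (×-card (A↔a z≤n) (B↔b z≤n)))
Conv-card (suc n) A↔a B↔b = ↔-trans Conv-suc (⊎-card (×-card (A↔a z≤n) (B↔b ℕ.≤-refl))
  (Conv-card n (A↔a ∘ s≤s) (B↔b ∘ ℕ.m≤n⇒m≤1+n)))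

catalan-suc : ∀ n → catalan (suc n) ≡ conv catalan catalan n
catalan-suc n = sumℕ-cong-≗ {suc n} λ i → trans
  (ℕ.*-comm (previous i) (previous (opposite i)))
  (cong₂ ℕ._*_
    (trans (history-lookup catalanStep (suc n) (opposite i)) (cong catalan (n∸opposite i)))
    (history-lookup catalanStep (suc n) i))
  where
  previous : Vector ℕ (suc n)
  previous = history catalanStep (suc n)

  n∸opposite : ∀ (i : Fin (suc n)) → n ∸ toℕ (opposite i) ≡ toℕ i
  n∸opposite i = trans (cong (n ∸_) (opposite-prop i)) (ℕ.m∸[m∸n]≡n (toℕ≤pred[n] i))

-- Bracketings and valuations

Bracketing-split : ∀ n → Bracketing n ↔ (n ≡ 1 ⊎ Conv Bracketing Bracketing n)
Bracketing-split n = mk↔ₛ′ to from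
  (λ { (inj₁ refl) → refl ; (inj₂ (_ , _ , refl , _)) → refl })
  (λ { var → refl ; (_ ⇒ _) → refl })
  where
  to : ∀ {n} → Bracketing n → n ≡ 1 ⊎ Conv Bracketing Bracketing n
  to var               = inj₁ refl
  to (_⇒_ {m} {k} φ ψ) = inj₂ (m , k , refl , φ , ψ)

  from : ∀ {n} → n ≡ 1 ⊎ Conv Bracketing Bracketing n → Bracketing n
  from (inj₁ refl)                   = var
  from (inj₂ (_ , _ , refl , φ , ψ)) = φ ⇒ ψ

-- The size is a variable with a separate inequality, because matching directly on `Bracketing 0`
-- would have to unify `m ℕ.+ n` with 0.
Bracketing-nonZero : ∀ {n} → Bracketing n → n ≢ 0
Bracketing-nonZero (_⇒_ {m} φ _) m+k≡0 = Bracketing-nonZero φ (ℕ.m+n≡0⇒m≡0 m m+k≡0)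

¬Bracketing₀ : ¬ Bracketing 0
¬Bracketing₀ φ = Bracketing-nonZero φ refl

⊎-identityˡ-¬ : ∀ {A B : Set} → ¬ A → (A ⊎ B) ↔ B
⊎-identityˡ-¬ ¬a = mk↔ₛ′ [ ⊥-elim ∘ ¬a , (λ b → b) ]′ inj₂ (λ _ → refl)
  (λ { (inj₁ a) → ⊥-elim (¬a a) ; (inj₂ _) → refl })

⊎-identityʳ-¬ : ∀ {A B : Set} → ¬ B → (A ⊎ B) ↔ A
⊎-identityʳ-¬ ¬b = mk↔ₛ′ [ (λ a → a) , ⊥-elim ∘ ¬b ]′ inj₁ (λ _ → refl)
  (λ { (inj₁ _) → refl ; (inj₂ b) → ⊥-elim (¬b b) })

¬Conv₁ : ∀ {A B} → ¬ A 0 → ¬ B 0 → ¬ Conv A B 1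
¬Conv₁ ¬A₀ ¬B₀ (zero     , _ , _    , a , _) = ¬A₀ a
¬Conv₁ ¬A₀ ¬B₀ (suc zero , _ , refl , _ , b) = ¬B₀ b

split-one-card : ∀ A B → ¬ A 0 → ¬ B 0 → (1 ≡ 1 ⊎ Conv A B 1) ↔ Fin 1
split-one-card A B ¬A₀ ¬B₀ = ↔-trans (⊎-identityʳ-¬ (¬Conv₁ ¬A₀ ¬B₀))
  (singleton-card refl (ℕ.≡-irrelevant refl))

split-suc-suc-card : ∀ A B {a b} n → ¬ A 0 → ¬ B 0 →
                     (∀ {m} → m ≤ n → A (suc m) ↔ Fin (a m)) →
                     (∀ {m} → m ≤ n → B (suc m) ↔ Fin (b m)) →
                     (suc (suc n) ≡ 1 ⊎ Conv A B (suc (suc n))) ↔ Fin (conv a b n)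
split-suc-suc-card A B n ¬A₀ ¬B₀ A↔a B↔b = ↔-trans (⊎-identityˡ-¬ λ ())
  (↔-trans (Conv-suc-suc ¬A₀ ¬B₀) (Conv-card n A↔a B↔b))

Bracketing-card : ∀ n → Bracketing (suc n) ↔ Fin (catalan n)
Bracketing-card = <-rec _ λ where
  zero    _   → ↔-trans (Bracketing-split 1)
    (split-one-card Bracketing Bracketing ¬Bracketing₀ ¬Bracketing₀)
  (suc n) rec → ↔-trans (Bracketing-split (suc (suc n))) (↔-card-resp (sym (catalan-suc n))
    (split-suc-suc-card Bracketing Bracketing n ¬Bracketing₀ ¬Bracketing₀ (rec ∘ s≤s) (rec ∘ s≤s)))

Valuation-card : ∀ n → Valuation n ↔ Fin (4 ℕ.^ n)
Valuation-card zero    = singleton-card [] (λ { [] → refl })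
Valuation-card (suc n) = ↔-trans
  (mk↔ₛ′ (λ { (x ∷ ρ) → x , ρ }) (uncurry _∷_) (λ _ → refl) (λ { (_ ∷ _) → refl }))
  (×-card (↔-id V₄) (Valuation-card n))

Pair-card : ∀ n → Pair (suc n) ↔ Fin (g (suc n))
Pair-card n = ↔-trans (×-comm _ _) (×-card (Valuation-card (suc n)) (Bracketing-card n))

-- Pairs counted by truth value

AtLeast Above : V₄ → V₄ → Set
AtLeast v w = v Fin.≤ w
Above   v w = v Fin.< w

Sat : (V₄ → Set) → ℕ → Set
Sat P n = Σ[ (φ , ρ) ∈ Pair n ] P (eval φ ρ)

¬Sat₀ : ∀ P → ¬ Sat P 0
¬Sat₀ P ((φ , _) , _) = ¬Bracketing₀ φ

Sat-≡ : ∀ P {n} → Unary.Irrelevant P → {s t : Sat P n} → proj₁ s ≡ proj₁ t → s ≡ t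
Sat-≡ P irr {_ , p} {_ , q} refl = cong (_ ,_) (irr p q)

≤-irr : ∀ v → Unary.Irrelevant (AtLeast v)
≤-irr v = ℕ.≤-irrelevant

<-irr : ∀ v → Unary.Irrelevant (Above v)
<-irr v = ℕ.≤-irrelevant

≡-irr : ∀ (v : V₄) → Unary.Irrelevant (_≡ v)
≡-irr v refl refl = refl

Sat-cong : ∀ P Q {n} → Unary.Irrelevant P → Unary.Irrelevant Q →
           (∀ {v} → P v ⇔ Q v) → Sat P n ↔ Sat Q n
Sat-cong P Q P-irr Q-irr P⇔Q = mk↔ₛ′
  (λ (π , p) → π , Equivalence.to P⇔Q p) (λ (π , q) → π , Equivalence.from P⇔Q q)
  (λ _ → Sat-≡ Q Q-irr refl) (λ _ → Sat-≡ P P-irr refl)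

-- Sizes start at 1, in accordance with `genCoeff`, which ignores the value at 0.
Count : (V₄ → Set) → (ℕ → ℕ) → Set
Count P c = ∀ n → Sat P (suc n) ↔ Fin (c (suc n))

-- The intermediate counts need no formula: a decidable condition on the finite type `Pair` has some
-- count.
Count-exists : ∀ {P} → Unary.Irrelevant P → Decidable P → ∃[ c ] Count P c
Count-exists {P} irr P? = c , λ n → proj₂ (finite n)
  where
  finite : ∀ n → ∃[ m ] (Sat P (suc n) ↔ Fin m)
  finite n = subset-finite (Pair-card n) irr (λ (φ , ρ) → P? (eval φ ρ))

  c : ℕ → ℕ
  -- A default value; `genCoeff` never reads it.
  c zero    = 0
  c (suc n) = proj₁ (finite n)

≤-dichotomy : ∀ v {n} → Sat (AtLeast v) n ↔ (Sat (Above v) n ⊎ Sat (_≡ v) n)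
≤-dichotomy v {n} = mk↔ₛ′ to from to∘from (λ s → Sat-≡ (AtLeast v) (≤-irr v) (proj₁-from∘to s))
  where
  to : Sat (AtLeast v) n → Sat (Above v) n ⊎ Sat (_≡ v) n
  to (π@(φ , ρ) , v≤) with eval φ ρ ≟ v
  ... | yes ≡v = inj₂ (π , ≡v)
  ... | no  ≢v = inj₁ (π , ≤∧≢⇒< v≤ (≢v ∘ sym))

  from : Sat (Above v) n ⊎ Sat (_≡ v) n → Sat (AtLeast v) n
  from (inj₁ (π , v<)) = π , ℕ.<⇒≤ v<
  from (inj₂ (π , ≡v)) = π , ≤-reflexive (sym ≡v)

  to∘from : ∀ s → to (from s) ≡ s
  to∘from (inj₁ ((φ , ρ) , v<)) with eval φ ρ ≟ v
  ... | yes ≡v = contradiction (cong toℕ (sym ≡v)) (ℕ.<⇒≢ v<)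
  ... | no  ≢v = cong inj₁ (Sat-≡ (Above v) (<-irr v) refl)
  to∘from (inj₂ ((φ , ρ) , ≡v)) with eval φ ρ ≟ v
  ... | yes _  = cong inj₂ (Sat-≡ (_≡ v) (≡-irr v) refl)
  ... | no  ≢v = contradiction ≡v ≢v

  proj₁-from∘to : ∀ s → proj₁ (from (to s)) ≡ proj₁ s
  proj₁-from∘to ((φ , ρ) , v≤) with eval φ ρ ≟ v
  ... | yes _ = refl
  ... | no  _ = refl

-- A value other than 1 can arise only in the branch x > y, where the implication returns y.
-- Conversely y = v < x excludes x ≤ y.
⇒ᴳ-value : ∀ {v x y} → v ≢ 𝟏 → (x ⇒ᴳ y) ≡ v ⇔ (v Fin.< x × y ≡ v)
⇒ᴳ-value {v} {x} {y} v≢𝟏 = if-value (x ≤? y)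
  where
  -- Generalising over the decision lets a match on it reduce the `if`.
  if-value : (x≤?y : Dec (x Fin.≤ y)) → (if does x≤?y then 𝟏 else y) ≡ v ⇔ (v Fin.< x × y ≡ v)
  if-value (yes x≤y) = mk⇔ (λ 𝟏≡v → contradiction (sym 𝟏≡v) v≢𝟏)
    (λ { (v<x , refl) → contradiction x≤y (ℕ.<⇒≱ v<x) })
  if-value (no x≰y)  = mk⇔ (λ { refl → ℕ.≰⇒> x≰y , refl }) proj₂

module _ {A : Set} {m n} (xs : Vec A m) (ys : Vec A n) where
  private
    split : take m (xs ++ ys) ≡ xs × drop m (xs ++ ys) ≡ ys
    split = ++-injective (take m (xs ++ ys)) xs (take++drop≡id m (xs ++ ys))

  take-++ : take m (xs ++ ys) ≡ xs
  take-++ = proj₁ split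

  drop-++ : drop m (xs ++ ys) ≡ ys
  drop-++ = proj₂ split

-- The bijection behind A= = x + A> A=. The variables are distinct, so a valuation of `φ ⇒ ψ` is an
-- independent pair of valuations, cut by `take` and `drop` and glued by `_++_`.
value-split : ∀ {v} n → v ≢ 𝟏 → Sat (_≡ v) n ↔ (n ≡ 1 ⊎ Conv (Sat (Above v)) (Sat (_≡ v)) n)
value-split {v} n v≢𝟏 = mk↔ₛ′ to from to∘from from∘to
  where
  to : ∀ {n} → Sat (_≡ v) n → n ≡ 1 ⊎ Conv (Sat (Above v)) (Sat (_≡ v)) n
  to ((var , _) , _) = inj₁ refl
  to ((_⇒_ {m} {k} φ ψ , ρ) , eq) =
    let v<x , y≡v = Equivalence.to (⇒ᴳ-value v≢𝟏) eq in
    inj₂ (m , k , refl , ((φ , take m ρ) , v<x) , ((ψ , drop m ρ) , y≡v))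

  from : ∀ {n} → n ≡ 1 ⊎ Conv (Sat (Above v)) (Sat (_≡ v)) n → Sat (_≡ v) n
  from (inj₁ refl) = (var , v ∷ []) , refl
  from (inj₂ (_ , _ , refl , ((φ , ρ) , v<x) , ((ψ , σ) , y≡v))) =
    (φ ⇒ ψ , ρ ++ σ) , Equivalence.from (⇒ᴳ-value v≢𝟏)
      ( subst (λ τ → v Fin.< eval φ τ) (sym (take-++ ρ σ)) v<x
      , subst (λ τ → eval ψ τ ≡ v) (sym (drop-++ ρ σ)) y≡v )

  to∘from : ∀ {n} (s : n ≡ 1 ⊎ Conv (Sat (Above v)) (Sat (_≡ v)) n) → to (from s) ≡ s
  to∘from (inj₁ refl) = refl
  to∘from (inj₂ (_ , _ , refl , ((φ , ρ) , _) , ((ψ , σ) , _))) =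
    cong₂ (λ s t → inj₂ (_ , _ , refl , s , t))
      (Sat-≡ (Above v) (<-irr v) (cong (φ ,_) (take-++ ρ σ)))
      (Sat-≡ (_≡ v) (≡-irr v) (cong (ψ ,_) (drop-++ ρ σ)))

  from∘to : ∀ {n} (s : Sat (_≡ v) n) → from (to s) ≡ s
  from∘to ((var , _ ∷ []) , refl)       = refl
  from∘to ((_⇒_ {m} φ ψ , ρ) , _) = Sat-≡ (_≡ v) (≡-irr v) (cong (φ ⇒ ψ ,_) (take++drop≡id m ρ))

-- Generating functions

fromℕ : ℕ → ℚ
fromℕ n = + n / 1

-- The fraction `+ n / 1` is normalised through a gcd that is stuck for a variable n. The explicit
-- form lets sums and products of such fractions compute.
fromℕ≡mkℚ : ∀ n → fromℕ n ≡ mkℚ (+ n) 0 (Coprimality.sym (Coprimality.1-coprimeTo n))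
fromℕ≡mkℚ n = ℚ.normalize-coprime (Coprimality.sym (Coprimality.1-coprimeTo n))

fromℕ-+ : ∀ m n → fromℕ (m ℕ.+ n) ≡ fromℕ m ℚ.+ fromℕ n
fromℕ-+ m n = sym (trans (cong₂ ℚ._+_ (fromℕ≡mkℚ m) (fromℕ≡mkℚ n))
  (cong (_/ 1) (cong₂ ℤ._+_ (ℤ.*-identityʳ (+ m)) (ℤ.*-identityʳ (+ n)))))

fromℕ-* : ∀ m n → fromℕ (m ℕ.* n) ≡ fromℕ m ℚ.* fromℕ n
fromℕ-* m n = sym (trans (cong₂ ℚ._*_ (fromℕ≡mkℚ m) (fromℕ≡mkℚ n))
  (cong (_/ 1) (sym (ℤ.pos-* m n))))

fromℕ-sum : ∀ {n} (v : Vector ℕ n) → fromℕ (sumℕ v) ≡ sum (fromℕ ∘ v)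
fromℕ-sum {zero}  v = refl
fromℕ-sum {suc n} v = trans (fromℕ-+ (v Fin.zero) (sumℕ (v ∘ Fin.suc)))
  (cong (fromℕ (v Fin.zero) ℚ.+_) (fromℕ-sum (v ∘ Fin.suc)))

fromℕ-conv : ∀ a b n → fromℕ (conv a b n) ≡ ((fromℕ ∘ a) * (fromℕ ∘ b)) n
fromℕ-conv a b n = trans (fromℕ-sum {suc n} λ i → a (toℕ i) ℕ.* b (n ∸ toℕ i))
  (sum-cong-≗ {suc n} λ i → fromℕ-* (a (toℕ i)) (b (n ∸ toℕ i)))

genCoeff-*-one : ∀ a b → (genCoeff a * genCoeff b) 1 ≡ 0ℚ
genCoeff-*-one a b = cong₂ (λ p q → p ℚ.+ (q ℚ.+ 0ℚ))
  (ℚ.*-zeroˡ (genCoeff b 1)) (ℚ.*-zeroʳ (genCoeff a 1))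

-- Both constant terms vanish, so the two end terms of the product drop out. This is the same shift
-- by two as in `Conv-suc-suc`.
genCoeff-*-suc-suc : ∀ a b n → (genCoeff a * genCoeff b) (suc (suc n)) ≡
                     fromℕ (conv (a ∘ suc) (b ∘ suc) n)
genCoeff-*-suc-suc a b n = begin
  0ℚ ℚ.* genCoeff b (suc (suc n)) ℚ.+ ((fromℕ ∘ a ∘ suc) * genCoeff b) (suc n)
    ≡⟨ cong₂ ℚ._+_ (ℚ.*-zeroˡ (genCoeff b (suc (suc n))))
         (*-sucʳ (fromℕ ∘ a ∘ suc) (genCoeff b) n) ⟩
  0ℚ ℚ.+ (fromℕ (a (suc (suc n))) ℚ.* 0ℚ ℚ.+ product)
    ≡⟨ trans (ℚ.+-identityˡ _) (cong (ℚ._+ product) (ℚ.*-zeroʳ (fromℕ (a (suc (suc n)))))) ⟩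
  0ℚ ℚ.+ product
    ≡⟨ ℚ.+-identityˡ product ⟩
  product
    ≡⟨ fromℕ-conv (a ∘ suc) (b ∘ suc) n ⟨
  fromℕ (conv (a ∘ suc) (b ∘ suc) n) ∎
  where
  open ≡-Reasoning
  product : ℚ
  product = ((fromℕ ∘ a ∘ suc) * (fromℕ ∘ b ∘ suc)) n

-- To be read with u, v, w as A>, A≥, A=. The hypotheses say v - u = w and w (1 - u) = x.
root-of-decomposition : ∀ {u v w} → v ≈ u + w → w ≈ X + u * w → Root u v
root-of-decomposition {u} {v} {w} v≈u+w w≈X+uw = begin
  (v - u) * (one - u)    ≈⟨ *-congʳ {one - u} (+-congʳ { - u} v≈u+w) ⟩
  (u + w - u) * (one - u)
    ≈⟨ solve 3 (λ i u w → (u :+ w :- u) :* (i :- u) := w :* i :- u :* w) ≈-refl one u w ⟩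
  w * one - u * w        ≈⟨ +-congʳ { - (u * w)} (≈-trans (*-identityʳ w) w≈X+uw) ⟩
  X + u * w - u * w      ≈⟨ solve 2 (λ x y → x :+ y :- y := x) ≈-refl X (u * w) ⟩
  X                      ∎
  where
  open SetoidReasoning setoid
  open Solver

module _ {v a b e} (v≢𝟏 : v ≢ 𝟏) (≤-count : Count (AtLeast v) a) (<-count : Count (Above v) b)
         (≡-count : Count (_≡ v) e) where

  count-≤ : ∀ n → a (suc n) ≡ b (suc n) ℕ.+ e (suc n)
  count-≤ n = ↔-card-unique (≤-count n) (↔-trans (≤-dichotomy v) (⊎-card (<-count n) (≡-count n)))

  count-≡-one : e 1 ≡ 1
  count-≡-one = ↔-card-unique (≡-count 0)
    (↔-trans (value-split 1 v≢𝟏)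
      (split-one-card (Sat (Above v)) (Sat (_≡ v)) (¬Sat₀ (Above v)) (¬Sat₀ (_≡ v))))

  count-≡-suc-suc : ∀ n → e (suc (suc n)) ≡ conv (b ∘ suc) (e ∘ suc) n
  count-≡-suc-suc n = ↔-card-unique (≡-count (suc n))
    (↔-trans (value-split (suc (suc n)) v≢𝟏)
      (split-suc-suc-card (Sat (Above v)) (Sat (_≡ v)) n (¬Sat₀ (Above v)) (¬Sat₀ (_≡ v))
        (λ _ → <-count _) (λ _ → ≡-count _)))

  count-root : Root (genCoeff b) (genCoeff a)
  count-root = root-of-decomposition {genCoeff b} {genCoeff a} {genCoeff e} A≈B+E E≈X+BE
    where
    A≈B+E : genCoeff a ≈ genCoeff b + genCoeff e
    A≈B+E zero    = refl
    A≈B+E (suc n) = trans (cong fromℕ (count-≤ n)) (fromℕ-+ (b (suc n)) (e (suc n)))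

    E≈X+BE : genCoeff e ≈ X + genCoeff b * genCoeff e
    E≈X+BE zero          = refl
    E≈X+BE (suc zero)    = trans (cong fromℕ count-≡-one)
      (sym (cong (1ℚ ℚ.+_) (genCoeff-*-one b e)))
    E≈X+BE (suc (suc n)) = trans (cong fromℕ (count-≡-suc-suc n))
      (sym (trans (ℚ.+-identityˡ _) (genCoeff-*-suc-suc b e n)))

-- Removes one truth value. The count of the pairs with value exactly v is auxiliary and is supplied
-- by `Count-exists`.
count-Ψ : ∀ v a b → v ≢ 𝟏 → Count (AtLeast v) a → Count (Above v) b → genFun b ≈₀ Ψ (genFun a)
count-Ψ v a b v≢𝟏 ≤-count <-count = root⇒Ψ (genFun b) (genFun a)
  (count-root {v} {a} {b} {proj₁ values} v≢𝟏 ≤-count <-count (proj₂ values))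
  where
  values : ∃ (Count (_≡ v))
  values = Count-exists (≡-irr v) (_≟ v)

count-all : Count (AtLeast 0F) g
count-all n = ↔-trans
  (mk↔ₛ′ proj₁ (λ π → π , z≤n) (λ _ → refl) (λ (π , _) → cong (π ,_) (ℕ.≤-irrelevant _ _)))
  (Pair-card n)

Above-2F⇔≡𝟏 : ∀ {v} → Above 2F v ⇔ v ≡ 𝟏
Above-2F⇔≡𝟏 = mk⇔ to λ { refl → ℕ.≤-refl }
  where
  to : ∀ {v} → Above 2F v → v ≡ 𝟏
  to {3F} _ = refl
  to {0F} ()
  to {1F} (s≤s ())
  to {2F} (s≤s (s≤s ()))

Above? : ∀ v → Decidable (Above v)
Above? v w = v <? w

truePair-genFun : ∀ t → (∀ n → 1 ≤ n → TruePair n ↔ Fin (t n)) → genFun t ≈₀ Ψ (Ψ (Ψ G))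
truePair-genFun t t-card = chain
  (Count-exists (<-irr 0F) (Above? 0F)) (Count-exists (<-irr 1F) (Above? 1F))
  where
  open SetoidReasoning setoid
  t-count : Count (Above 2F) t
  t-count n = ↔-trans (Sat-cong (Above 2F) (_≡ 𝟏) (<-irr 2F) (≡-irr 𝟏) Above-2F⇔≡𝟏)
    (t-card (suc n) (s≤s z≤n))

  chain : ∃ (Count (Above 0F)) → ∃ (Count (Above 1F)) → genFun t ≈₀ Ψ (Ψ (Ψ G))
  -- `Above 0F` and `AtLeast 1F` agree by definition, as do `Above 1F` and `AtLeast 2F`. Hence each
  -- count of values above v serves as the count of values at least the next one.
  chain (c₁ , count₁) (c₂ , count₂) = begin
    genCoeff t
      ≈⟨ count-Ψ 2F c₂ t (λ ()) count₂ t-count ⟩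
    proj₁ (Ψ (genFun c₂))
      ≈⟨ Ψ-cong {genFun c₂} {Ψ (genFun c₁)} (count-Ψ 1F c₁ c₂ (λ ()) count₁ count₂) ⟩
    proj₁ (Ψ (Ψ (genFun c₁)))
      ≈⟨ Ψ-cong {Ψ (genFun c₁)} {Ψ (Ψ G)}
           (Ψ-cong {genFun c₁} {Ψ G} (count-Ψ 0F g c₁ (λ ()) count-all count₁)) ⟩
    proj₁ (Ψ (Ψ (Ψ G))) ∎

-- The closed form of G

g-suc-suc : ∀ n → g (suc (suc n)) ≡ conv (g ∘ suc) (g ∘ suc) n
g-suc-suc n = begin
  4 ℕ.^ suc (suc n) ℕ.* catalan (suc n)        ≡⟨ cong (4 ℕ.^ suc (suc n) ℕ.*_) (catalan-suc n) ⟩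
  4 ℕ.^ suc (suc n) ℕ.* conv catalan catalan n
    ≡⟨ *-distribˡ-sumℕ {suc n} (4 ℕ.^ suc (suc n)) (λ i → catalan (toℕ i) ℕ.* catalan (n ∸ toℕ i)) ⟩
  sumℕ {suc n} (λ i → 4 ℕ.^ suc (suc n) ℕ.* (catalan (toℕ i) ℕ.* catalan (n ∸ toℕ i)))
    ≡⟨ sumℕ-cong-≗ {suc n} (λ i → term (toℕ i) (toℕ≤pred[n] i)) ⟩
  conv (g ∘ suc) (g ∘ suc) n                   ∎
  where
  open ≡-Reasoning
  -- The two subtrees have i + 1 and n - i + 1 leaves, n + 2 in total, so the power of 4 splits
  -- between them.
  term : ∀ i → i ≤ n → 4 ℕ.^ suc (suc n) ℕ.* (catalan i ℕ.* catalan (n ∸ i))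
                     ≡ g (suc i) ℕ.* g (suc (n ∸ i))
  term i i≤n = begin
    4 ℕ.^ suc (suc n) ℕ.* (catalan i ℕ.* catalan (n ∸ i))
      ≡⟨ cong (ℕ._* (catalan i ℕ.* catalan (n ∸ i))) (trans
           (cong (λ k → 4 ℕ.^ suc k) (trans
             (cong suc (sym (ℕ.m+[n∸m]≡n i≤n))) (sym (ℕ.+-suc i (n ∸ i)))))
           (ℕ.^-distribˡ-+-* 4 (suc i) (suc (n ∸ i)))) ⟩
    4 ℕ.^ suc i ℕ.* 4 ℕ.^ suc (n ∸ i) ℕ.* (catalan i ℕ.* catalan (n ∸ i))
      ≡⟨ ℕ.[m*n]*[o*p]≡[m*o]*[n*p] (4 ℕ.^ suc i) (4 ℕ.^ suc (n ∸ i)) (catalan i) (catalan (n ∸ i)) ⟩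
    g (suc i) ℕ.* g (suc (n ∸ i)) ∎

-- A pair is a variable with one of four values or an arbitrary implication of two pairs.
G≈4X+G² : proj₁ G ≈ const (+ 4 / 1) * X + proj₁ G * proj₁ G
G≈4X+G² n = trans (coeff n) (cong (ℚ._+ (proj₁ G * proj₁ G) n) (·≈const* (+ 4 / 1) X n))
  where
  coeff : proj₁ G ≈ (+ 4 / 1) · X + proj₁ G * proj₁ G
  coeff zero          = refl
  coeff (suc zero)    = sym (cong ((+ 4 / 1) ℚ.+_) (genCoeff-*-one g g))
  coeff (suc (suc n)) = trans (cong fromℕ (g-suc-suc n))
    (sym (trans (ℚ.+-identityˡ _) (genCoeff-*-suc-suc g g n)))

-- From f = 4x + f² follows (1 - 2f)² = 1 - 16x. As f has zero constant term, 1 - 2f has constant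
-- term 1 and is therefore the square root chosen by `√`.
quadratic-closed-form : ∀ {f} → f 0 ≡ 0ℚ → f ≈ const (+ 4 / 1) * X + f * f →
                        f ≈ ½ · (one - √ (one - (+ 16 / 1) · X))
quadratic-closed-form {f} f₀≡0 f≈4X+f² = begin
  f
    ≈⟨ solve 2 (λ i f → f := con ½ :* (i :- (i :- con (+ 2 / 1) :* f))) ≈-refl one f ⟩
  const ½ * (one - s)      ≈⟨ *-congˡ {const ½} (+-congˡ {one} (-‿cong s≈√d)) ⟩
  const ½ * (one - √ d)    ≈⟨ ½·≈const* (one - √ d) ⟨
  ½ · (one - √ d)          ∎
  where
  open SetoidReasoning setoid
  open Solver
  d s : Series
  d = one - (+ 16 / 1) · X
  s = one - const (+ 2 / 1) * f

  s²≈d : s * s ≈ d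
  s²≈d = begin
    s * s
      ≈⟨ solve 2 (λ i f → (i :- con (+ 2 / 1) :* f) :* (i :- con (+ 2 / 1) :* f)
           := i :* i :- con (+ 4 / 1) :* (f :* i :- f :* f)) ≈-refl one f ⟩
    one * one - const (+ 4 / 1) * (f * one - f * f)
      ≈⟨ +-cong (*-identityʳ one) (-‿cong (*-congˡ {const (+ 4 / 1)}
           (+-congʳ { - (f * f)} (≈-trans (*-identityʳ f) f≈4X+f²)))) ⟩
    one - const (+ 4 / 1) * (const (+ 4 / 1) * X + f * f - f * f)
      ≈⟨ solve 3 (λ i x q → i :- con (+ 4 / 1) :* (con (+ 4 / 1) :* x :+ q :- q)
           := i :- con (+ 16 / 1) :* x) ≈-refl one X (f * f) ⟩
    one - const (+ 16 / 1) * X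
      ≈⟨ +-congˡ {one} (-‿cong (·≈const* (+ 16 / 1) X)) ⟨
    d ∎

  s≈√d : s ≈ √ d
  s≈√d = isUnitSqrt-unique {d} {s} {√ d}
    (cong (λ q → 1ℚ ℚ.- ((+ 2 / 1) ℚ.* 1ℚ ℚ.* q ℚ.+ 0ℚ)) f₀≡0 , s²≈d) (√-isUnitSqrt d refl)

G-closed-form : proj₁ G ≈ ½ · (one - √ (one - (+ 16 / 1) · X))
G-closed-form = quadratic-closed-form {proj₁ G} refl G≈4X+G²

proposition3 : (∀ f → f 0 ≡ 1ℚ → f * recip f ≈ one)
    × (∀ f → f 0 ≡ 1ℚ →
    IsUnitSqrt (√ f) f × (∀ s → IsUnitSqrt s f → s ≈ √ f))
    × IsInverse Φ Ψ
    × (∀ v → Φ (Ψ v) ≈₀ v × (∀ w → Φ w ≈₀ v → w ≈₀ Ψ v))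
    × (∀ n → 1 ≤ n → Pair n ↔ Fin (g n))
    × (∀ (t : ℕ → ℕ) → (∀ n → 1 ≤ n → TruePair n ↔ Fin (t n)) →
    genFun t ≈₀ Ψ (Ψ (Ψ G)))
    × proj₁ G ≈ ½ · (one - √ (one - (+ 16 / 1) · X))
proposition3 =
    *-recip
  , (λ f f₀≡1 → √-isUnitSqrt f f₀≡1 ,
      λ s s-isUnitSqrt → isUnitSqrt-unique {f} {s} {√ f} s-isUnitSqrt (√-isUnitSqrt f f₀≡1))
  , Φ-Ψ-isInverse
  , (λ v → Ψ⇒Φ (Ψ v) v ≈-refl , λ w → Φ⇒Ψ w v)
  , (λ { (suc n) _ → Pair-card n })
  , truePair-genFun
  , G-closed-form
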